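{- Let $r$ be a positive integer. Let $(S_n(X))_{n\ge 0}$ be the Carlitz-type $q$-polynomial sequence associated to the real sequence $a_k=\frac{1}{q-1}\cdot\frac{1}{[k+r]}$ ($k\ge 0$). Then for every integer $n\ge 0$ and every positive integer $N$, $$\sum_{k=0}^{N-1}q^{rk}[k]^n=q^{rN}S_n(N)-S_n(0).$$
   Context: Let $q$ be a positive real number, $q\neq 1$, and put $[X]:=\frac{q^X-1}{q-1}$. The Carlitz-type $q$-polynomial sequence associated to a real sequence $(a_k)_{k\ge 0}$ is the sequence $(T_n(X))_{n\ge 0}$ defined by $$T_n(X)=(q-1)^{ -n}\sum_{k=0}^{n}(-1)^{n-k}\binom{n}{k}a_k\,q^{kX}.$$ The convention $[k]^0=1$ (also for $k=0$) is used. -}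

module Defs where

open import Algebra.Apartness.Bundles using (HeytingCommutativeRing; HeytingField)
import Algebra.Apartness.Properties.HeytingCommutativeRing as HeytingProperties
open import Algebra.Bundles using (CommutativeRing; Semiring)
import Algebra.Definitions.RawSemiring as SemiringDefinitions
open import Data.Fin.Base using (toℕ)
open import Data.Nat.Base as ℕ using (ℕ; zero; suc; NonZero)
open import Data.Nat.Combinatorics using (_C_)
import Data.Nat.Properties as ℕ using (+-comm)
open import Data.Product.Base using (Σ-syntax; _,_; proj₁; proj₂) renaming (_×_ to _and_)
open import Data.Sum.Base using (_⊎_; inj₁; inj₂)
open import Level using (_⊔_) renaming (suc to lsuc)
open import Relation.Binary.Core using (Rel)
open import Relation.Binary.PropositionalEquality.Core using (subst)
open import Relation.Binary.Structures using (IsStrictPartialOrder)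

-- The library has no real numbers, so ℝ is given by its axioms: it is the
-- Archimedean, Cauchy complete ordered field (unique up to isomorphism).  The
-- axioms are the constructive ones: `x # y` is the positive form of x ≠ y,
-- equivalent to x < y or y < x, and limits are given as data.
record RealNumbers c ℓ₁ ℓ₂ : Set (lsuc (c ⊔ ℓ₁ ⊔ ℓ₂)) where
  infix 4 _<_
  field
    heytingField : HeytingField c ℓ₁ ℓ₂

  open HeytingField heytingField public renaming (zero to *-zero)

  commutativeRing : CommutativeRing c ℓ₁
  commutativeRing = HeytingCommutativeRing.commutativeRing heytingCommutativeRing

  semiring : Semiring c ℓ₁
  semiring = CommutativeRing.semiring commutativeRing

  open SemiringDefinitions (Semiring.rawSemiring semiring) public
    using (_^_; _×_; sum)

  fromℕ : ℕ → Carrier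
  fromℕ n = n × 1#

  field
    _<_                  : Rel Carrier ℓ₂
    isStrictPartialOrder : IsStrictPartialOrder _≈_ _<_
    #⇒<⊎>                : ∀ {x y} → x # y → x < y ⊎ y < x
    <⇒#                  : ∀ {x y} → x < y → x # y
    +-monoˡ-<            : ∀ z {x y} → x < y → x + z < y + z
    *-positive           : ∀ {x y} → 0# < x → 0# < y → 0# < x * y
    archimedean          : ∀ x → Σ[ n ∈ ℕ ] x < fromℕ n

  -- |x - y| < ε
  Within : Carrier → Carrier → Carrier → Set ℓ₂
  Within ε x y = (- ε < x - y) and (x - y < ε)

  Cauchy : (ℕ → Carrier) → Set (c ⊔ ℓ₂)
  Cauchy u = ∀ ε → 0# < ε →
    Σ[ M ∈ ℕ ] (∀ m n → M ℕ.≤ m → M ℕ.≤ n → Within ε (u m) (u n))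

  _ConvergesTo_ : (ℕ → Carrier) → Carrier → Set (c ⊔ ℓ₂)
  u ConvergesTo l = ∀ ε → 0# < ε →
    Σ[ M ∈ ℕ ] (∀ n → M ℕ.≤ n → Within ε (u n) l)

  field
    complete : ∀ u → Cauchy u → Σ[ l ∈ Carrier ] (u ConvergesTo l)

  infix 9 _⁻¹⟨_⟩
  _⁻¹⟨_⟩ : ∀ x → x # 0# → Carrier
  x ⁻¹⟨ x#0 ⟩ = proj₁ (#⇒invertible x#0)

-- The function X ↦ q^X of a real variable (for q > 0): the unique continuous
-- homomorphism from addition to multiplication taking the value q at 1.
record PowerFunction {c ℓ₁ ℓ₂} (ℝ : RealNumbers c ℓ₁ ℓ₂)
                     (q : RealNumbers.Carrier ℝ) : Set (c ⊔ ℓ₁ ⊔ ℓ₂) where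
  open RealNumbers ℝ
  infix 9 q^_
  field
    q^_           : Carrier → Carrier
    q^-cong       : ∀ {x y} → x ≈ y → q^ x ≈ q^ y
    q^-homo       : ∀ x y → q^ (x + y) ≈ q^ x * q^ y
    q^-1          : q^ 1# ≈ q
    q^-continuous : ∀ x ε → 0# < ε →
      Σ[ δ ∈ Carrier ] ((0# < δ) and (∀ y → Within δ y x → Within ε (q^ y) (q^ x)))

module _ {c ℓ₁ ℓ₂} (ℝ : RealNumbers c ℓ₁ ℓ₂) where

  open RealNumbers ℝ

  module Carlitz {q : Carrier} (0<q : 0# < q) (q#1 : q # 1#)
                 (power : PowerFunction ℝ q) where

    open PowerFunction power public

    private
      module H = HeytingProperties heytingCommutativeRing
      module O = IsStrictPartialOrder isStrictPartialOrder

      #⇒-#0 : ∀ {x y} → x # y → x - y # 0#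
      #⇒-#0 {x} {y} x#y with #⇒invertible x#y
      ... | z , z*[x-y]≈1 , _ =
        H.invertibleˡ⇒# (z , trans (*-congˡ (H.x-0≈x (x - y))) z*[x-y]≈1)

      ⁻¹#0 : ∀ {x} (x#0 : x # 0#) → x ⁻¹⟨ x#0 ⟩ # 0#
      ⁻¹#0 {x} x#0 with #⇒invertible x#0
      ... | z , _ , [x-0]*z≈1 =
        H.invertibleˡ⇒# (x - 0# , trans (*-congˡ (H.x-0≈x z)) [x-0]*z≈1)

    q-1#0 : q - 1# # 0#
    q-1#0 = #⇒-#0 q#1

    [_] : Carrier → Carrier
    [ X ] = (q^ X - 1#) * (q - 1#) ⁻¹⟨ q-1#0 ⟩

    carlitz : (ℕ → Carrier) → ℕ → Carrier → Carrier
    carlitz a n X =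
      ((q - 1#) ⁻¹⟨ q-1#0 ⟩) ^ n *
      sum {suc n} (λ i → let k = toℕ i in
        (- 1#) ^ (n ℕ.∸ k) * fromℕ (n C k) * a k * q^ (fromℕ k * X))

    private
      *-monoʳ : ∀ {x y} → x < y → q * x < q * y
      *-monoʳ {x} {y} x<y = O.<-respˡ-≈ (+-identityˡ (q * x)) (O.<-respʳ-≈ eq
        (+-monoˡ-< (q * x) (*-positive 0<q
          (O.<-respˡ-≈ (-‿inverseʳ x) (+-monoˡ-< (- x) x<y)))))
        where
        eq : q * (y - x) + q * x ≈ q * y
        eq = trans (sym (distribˡ q (y - x) x))
               (*-congˡ (trans (+-assoc y (- x) x)
                 (trans (+-congˡ (-‿inverseˡ x)) (+-identityʳ y))))

      q^1 : q^ fromℕ 1 ≈ q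
      q^1 = trans (q^-cong (+-identityʳ 1#)) q^-1

      q^suc : ∀ m → q^ fromℕ (suc m) ≈ q * q^ fromℕ m
      q^suc m = trans (q^-homo 1# (fromℕ m)) (*-congʳ q^-1)

      q^<1 : q < 1# → ∀ m → q^ fromℕ (suc m) < 1#
      q^<1 q<1 zero    = O.<-respˡ-≈ (sym q^1) q<1
      q^<1 q<1 (suc m) = O.<-respˡ-≈ (sym (q^suc (suc m)))
        (O.trans (O.<-respʳ-≈ (*-identityʳ q) (*-monoʳ (q^<1 q<1 m))) q<1)

      1<q^ : 1# < q → ∀ m → 1# < q^ fromℕ (suc m)
      1<q^ 1<q zero    = O.<-respʳ-≈ (sym q^1) 1<q
      1<q^ 1<q (suc m) = O.<-respʳ-≈ (sym (q^suc (suc m)))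
        (O.trans 1<q (O.<-respˡ-≈ (*-identityʳ q) (*-monoʳ (1<q^ 1<q m))))

      q^#1 : ∀ m → q^ fromℕ (suc m) # 1#
      q^#1 m with #⇒<⊎> q#1
      ... | inj₁ q<1 = <⇒# (q^<1 q<1 m)
      ... | inj₂ 1<q = #-sym (<⇒# (1<q^ 1<q m))

    [k+r]#0 : ∀ k r .{{_ : NonZero r}} → [ fromℕ (k ℕ.+ r) ] # 0#
    [k+r]#0 k (suc r) = subst (λ m → [ fromℕ m ] # 0#) (ℕ.+-comm (suc r) k)
      (H.x#0y#0→xy#0 (#⇒-#0 (q^#1 (r ℕ.+ k))) (⁻¹#0 q-1#0))

-- Write i = 1/(q - 1).  The k-th term of q^(rj) S_n(j) is a constant times
-- a_k q^((k+r)j), and a_k = 1/(q^(k+r) - 1), so that a_k q^(k+r) = a_k + 1.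
-- Passing from j to j + 1 therefore adds
--   i^n Σ_k (-1)^(n-k) C(n,k) q^((k+r)j) = q^(rj) i^n (q^j - 1)^n = q^(rj) [j]^n
-- by the binomial theorem, and the sum telescopes.
module Submission where

open import Defs
open import Algebra.Bundles using (CommutativeRing)
import Algebra.Apartness.Properties.HeytingCommutativeRing as HeytingProperties
import Algebra.Properties.CommutativeSemiring.Binomial as Binomial
import Algebra.Properties.CommutativeSemiring.Exp as CommutativeExp
import Algebra.Properties.Group as GroupProperties
import Algebra.Properties.AbelianGroup as AbelianGroupProperties
import Algebra.Properties.Semiring.Exp as Exp
import Algebra.Properties.Semiring.Mult as Mult
import Algebra.Properties.Semiring.Sum as Sum
import Algebra.Solver.Ring.NaturalCoefficients.Default as SemiringSolver
open import Data.Fin.Base using (Fin; toℕ)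
open import Data.Nat.Base as ℕ using (ℕ; zero; suc; NonZero)
open import Data.Nat.Combinatorics using (_C_)
import Data.Nat.Properties as ℕ
open import Data.Product.Base using (proj₁; proj₂)
import Relation.Binary.PropositionalEquality as ≡
import Relation.Binary.Reasoning.Setoid as SetoidReasoning

module _ {c ℓ₁ ℓ₂} (ℝ : RealNumbers c ℓ₁ ℓ₂) where

  open RealNumbers ℝ
  open CommutativeRing commutativeRing using (commutativeSemiring; +-group; +-abelianGroup)
  open GroupProperties +-group using (//-rightDividesˡ)
  open AbelianGroupProperties +-abelianGroup using (xyx⁻¹≈y)
  open HeytingProperties heytingCommutativeRing using (x-0≈x)
  open Exp semiring using (^-congˡ; ^-congʳ; ^-homo-*; ^-assocʳ)
  open CommutativeExp commutativeSemiring using (^-distrib-*)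
  open Mult semiring using (×1-homo-*; ×-assoc-*; ×-congʳ)
  open Sum semiring using (sum-cong-≋; ∑-distrib-+; *-distribˡ-sum)
  open SemiringSolver commutativeSemiring using (solve; _:=_; _:*_; _:+_; con)
  open SetoidReasoning setoid

  -- `#⇒invertible` supplies an inverse of the difference `x - 0#`, which is then identified with
  -- `x`.
  ⁻¹-inverseˡ : ∀ {x} (x#0 : x # 0#) → x ⁻¹⟨ x#0 ⟩ * x ≈ 1#
  ⁻¹-inverseˡ {x} x#0 =
    trans (*-congˡ (sym (x-0≈x x))) (proj₁ (proj₂ (#⇒invertible x#0)))

  -- Induction on `N` for all `F` and `f` at once: `sum` splits off its first term, so the
  -- hypothesis is applied to both sequences shifted by one.
  telescope : (F f : ℕ → Carrier) → (∀ j → F (suc j) ≈ F j + f j) →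
              ∀ N → F N ≈ F 0 + sum {N} (λ j → f (toℕ j))
  telescope F f step zero    = sym (+-identityʳ (F 0))
  telescope F f step (suc N) = begin
    F (suc N)                                        ≈⟨ telescope (λ j → F (suc j)) (λ j → f (suc j)) (λ j → step (suc j)) N ⟩
    F 1 + sum {N} (λ j → f (suc (toℕ j)))            ≈⟨ +-congʳ (step 0) ⟩
    F 0 + f 0 + sum {N} (λ j → f (suc (toℕ j)))      ≈⟨ +-assoc _ _ _ ⟩
    F 0 + (f 0 + sum {N} (λ j → f (suc (toℕ j))))    ∎

  binomial-[x-1]^n : ∀ x n →
    sum {suc n} (λ i → (- 1#) ^ (n ℕ.∸ toℕ i) * fromℕ (n C toℕ i) * x ^ toℕ i) ≈ (x - 1#) ^ n
  binomial-[x-1]^n x n = begin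
    sum {suc n} (λ i → (- 1#) ^ (n ℕ.∸ toℕ i) * fromℕ (n C toℕ i) * x ^ toℕ i)
      ≈⟨ sum-cong-≋ {suc n} term ⟩
    sum {suc n} (λ i → (n C toℕ i) × (x ^ toℕ i * (- 1#) ^ (n ℕ.∸ toℕ i)))
      ≈⟨ Binomial.theorem commutativeSemiring n x (- 1#) ⟨
    (x - 1#) ^ n ∎
    where
    term : ∀ (i : Fin (suc n)) →
           (- 1#) ^ (n ℕ.∸ toℕ i) * fromℕ (n C toℕ i) * x ^ toℕ i
             ≈ (n C toℕ i) × (x ^ toℕ i * (- 1#) ^ (n ℕ.∸ toℕ i))
    term i = begin
      s * b * p                              ≈⟨ solve 3 (λ s b p → s :* b :* p := b :* (p :* s)) refl s b p ⟩
      -- `b` unfolds to `(n C toℕ i) × 1#`, so multiplying by it is repeated addition, the form of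
      -- the coefficients in the binomial theorem.
      b * (p * s)                            ≈⟨ ×-assoc-* (n C toℕ i) 1# (p * s) ⟩
      (n C toℕ i) × (1# * (p * s))           ≈⟨ ×-congʳ (n C toℕ i) (*-identityˡ (p * s)) ⟩
      (n C toℕ i) × (p * s)                  ∎
      where
      s = (- 1#) ^ (n ℕ.∸ toℕ i)
      b = fromℕ (n C toℕ i)
      p = x ^ toℕ i

  module _ {q : Carrier} (0<q : 0# < q) (q#1 : q # 1#) (power : PowerFunction ℝ q) where

    open Carlitz ℝ 0<q q#1 power

    -- Since `0# + 1#` is `1#`, multiplying `q` by `q^ 0#` returns `q`; positivity makes `q`
    -- invertible, so it cancels.
    q^0≈1 : q^ 0# ≈ 1#
    q^0≈1 = begin
      q^ 0#                   ≈⟨ *-identityʳ (q^ 0#) ⟨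
      q^ 0# * 1#              ≈⟨ *-congˡ q*q⁻¹≈1 ⟨
      q^ 0# * (q * q⁻¹)       ≈⟨ *-assoc (q^ 0#) q q⁻¹ ⟨
      q^ 0# * q * q⁻¹         ≈⟨ *-congʳ q^0*q≈q ⟩
      q * q⁻¹                 ≈⟨ q*q⁻¹≈1 ⟩
      1#                      ∎
      where
      q#0 : q # 0#
      q#0 = #-sym (<⇒# 0<q)

      q⁻¹ : Carrier
      q⁻¹ = q ⁻¹⟨ q#0 ⟩

      q*q⁻¹≈1 : q * q⁻¹ ≈ 1#
      q*q⁻¹≈1 = trans (*-comm q q⁻¹) (⁻¹-inverseˡ q#0)

      q^0*q≈q : q^ 0# * q ≈ q
      q^0*q≈q = begin
        q^ 0# * q         ≈⟨ *-congˡ q^-1 ⟨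
        q^ 0# * q^ 1#     ≈⟨ q^-homo 0# 1# ⟨
        q^ (0# + 1#)      ≈⟨ q^-cong (+-identityˡ 1#) ⟩
        q^ 1#             ≈⟨ q^-1 ⟩
        q                 ∎

    -- Bridges real and iterated powers, so that exponents can be manipulated in ℕ.
    q^fromℕ : ∀ m → q^ fromℕ m ≈ q ^ m
    q^fromℕ zero    = q^0≈1
    q^fromℕ (suc m) = trans (q^-homo 1# (fromℕ m)) (*-cong q^-1 (q^fromℕ m))

    q^fromℕ-* : ∀ k m → q^ (fromℕ k * fromℕ m) ≈ q ^ (k ℕ.* m)
    q^fromℕ-* k m = trans (q^-cong (sym (×1-homo-* k m))) (q^fromℕ (k ℕ.* m))

    i : Carrier
    i = (q - 1#) ⁻¹⟨ q-1#0 ⟩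

    -- The factor 1/(q - 1) in `a` cancels the denominator of `[ fromℕ m ]`, leaving `a` = 1/(q^m -
    -- 1).
    a*q^m≈a+1 : ∀ m (m#0 : [ fromℕ m ] # 0#) →
                let a = i * [ fromℕ m ] ⁻¹⟨ m#0 ⟩ in a * q ^ m ≈ a + 1#
    a*q^m≈a+1 m m#0 = begin
      a * q ^ m                          ≈⟨ *-congˡ (q^fromℕ m) ⟨
      a * e                              ≈⟨ *-congˡ (//-rightDividesˡ 1# e) ⟨
      a * (e - 1# + 1#)                  ≈⟨ distribˡ a (e - 1#) 1# ⟩
      a * (e - 1#) + a * 1#              ≈⟨ +-cong a*[e-1]≈1 (*-identityʳ a) ⟩
      1# + a                             ≈⟨ +-comm 1# a ⟩
      a + 1#                             ∎
      where
      e = q^ fromℕ m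
      v = [ fromℕ m ] ⁻¹⟨ m#0 ⟩
      a = i * v

      a*[e-1]≈1 : a * (e - 1#) ≈ 1#
      a*[e-1]≈1 = begin
        a * (e - 1#)                         ≈⟨ *-identityʳ _ ⟨
        -- The inserted 1 brings a second `i`, which turns `e - 1#` into `[ fromℕ m ]`, and a factor
        -- `q - 1#`, which cancels the `i` in `a`.
        a * (e - 1#) * 1#                    ≈⟨ *-congˡ (⁻¹-inverseˡ q-1#0) ⟨
        a * (e - 1#) * (i * (q - 1#))        ≈⟨ solve 4 (λ i v d p → i :* v :* d :* (i :* p) := i :* p :* (v :* (d :* i))) refl i v (e - 1#) (q - 1#) ⟩
        i * (q - 1#) * (v * [ fromℕ m ])     ≈⟨ *-cong (⁻¹-inverseˡ q-1#0) (⁻¹-inverseˡ m#0) ⟩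
        1# * 1#                              ≈⟨ *-identityˡ 1# ⟩
        1#                                   ∎

    module _ (r : ℕ) (n : ℕ) where

      signedBinomial : ℕ → Carrier
      signedBinomial k = (- 1#) ^ (n ℕ.∸ k) * fromℕ (n C k)

      -- Absorbing the outer power into each term shifts its exponent from kj to (k + r)j, matching
      -- the index in the denominator of a_k.
      q^[rj]*carlitz : ∀ a j →
        q^ fromℕ (r ℕ.* j) * carlitz a n (fromℕ j)
          ≈ i ^ n * sum {suc n} (λ l → signedBinomial (toℕ l) * a (toℕ l) * q ^ ((toℕ l ℕ.+ r) ℕ.* j))
      q^[rj]*carlitz a j = begin
        Q * (i ^ n * sum {suc n} T)                ≈⟨ solve 3 (λ Q I S → Q :* (I :* S) := I :* (Q :* S)) refl Q (i ^ n) (sum {suc n} T) ⟩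
        i ^ n * (Q * sum {suc n} T)                ≈⟨ *-congˡ (*-distribˡ-sum {suc n} Q T) ⟩
        i ^ n * sum {suc n} (λ l → Q * T l)        ≈⟨ *-congˡ (sum-cong-≋ {suc n} term) ⟩
        i ^ n * sum {suc n} (λ l → signedBinomial (toℕ l) * a (toℕ l) * q ^ ((toℕ l ℕ.+ r) ℕ.* j)) ∎
        where
        Q = q^ fromℕ (r ℕ.* j)

        T : Fin (suc n) → Carrier
        T l = signedBinomial (toℕ l) * a (toℕ l) * q^ (fromℕ (toℕ l) * fromℕ j)

        term : ∀ l → Q * T l ≈ signedBinomial (toℕ l) * a (toℕ l) * q ^ ((toℕ l ℕ.+ r) ℕ.* j)
        term l = begin
          Q * (b * x)                                ≈⟨ solve 3 (λ Q b x → Q :* (b :* x) := b :* (x :* Q)) refl Q b x ⟩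
          b * (x * Q)                                ≈⟨ *-congˡ (*-cong (q^fromℕ-* k j) (q^fromℕ (r ℕ.* j))) ⟩
          b * (q ^ (k ℕ.* j) * q ^ (r ℕ.* j))        ≈⟨ *-congˡ (^-homo-* q (k ℕ.* j) (r ℕ.* j)) ⟨
          b * q ^ (k ℕ.* j ℕ.+ r ℕ.* j)              ≈⟨ *-congˡ (^-congʳ q (ℕ.*-distribʳ-+ j k r)) ⟨
          b * q ^ ((k ℕ.+ r) ℕ.* j)                  ∎
          where
          k = toℕ l
          b = signedBinomial k * a k
          x = q^ (fromℕ k * fromℕ j)

      -- The common factor q^(rj) comes out of the sum, and what remains is the binomial expansion
      -- of (q^j - 1)^n.
      q^[rj]*[j]^n : ∀ j →
        i ^ n * sum {suc n} (λ l → signedBinomial (toℕ l) * q ^ ((toℕ l ℕ.+ r) ℕ.* j))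
          ≈ q^ fromℕ (r ℕ.* j) * [ fromℕ j ] ^ n
      q^[rj]*[j]^n j = begin
        i ^ n * sum {suc n} (λ l → signedBinomial (toℕ l) * q ^ ((toℕ l ℕ.+ r) ℕ.* j))
          ≈⟨ *-congˡ (sum-cong-≋ {suc n} term) ⟩
        i ^ n * sum {suc n} (λ l → Q * T l)
          ≈⟨ *-congˡ (*-distribˡ-sum {suc n} Q T) ⟨
        i ^ n * (Q * sum {suc n} T)
          ≈⟨ *-congˡ (*-congˡ (binomial-[x-1]^n x n)) ⟩
        i ^ n * (Q * (x - 1#) ^ n)
          ≈⟨ solve 3 (λ I Q X → I :* (Q :* X) := Q :* (X :* I)) refl (i ^ n) Q ((x - 1#) ^ n) ⟩
        Q * ((x - 1#) ^ n * i ^ n)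
          ≈⟨ *-congˡ (^-distrib-* (x - 1#) i n) ⟨
        Q * [ fromℕ j ] ^ n ∎
        where
        Q = q^ fromℕ (r ℕ.* j)
        x = q^ fromℕ j

        T : Fin (suc n) → Carrier
        T l = signedBinomial (toℕ l) * x ^ toℕ l

        term : ∀ l → signedBinomial (toℕ l) * q ^ ((toℕ l ℕ.+ r) ℕ.* j) ≈ Q * T l
        term l = begin
          b * q ^ ((k ℕ.+ r) ℕ.* j)                  ≈⟨ *-congˡ (^-congʳ q (ℕ.*-distribʳ-+ j k r)) ⟩
          b * q ^ (k ℕ.* j ℕ.+ r ℕ.* j)              ≈⟨ *-congˡ (^-homo-* q (k ℕ.* j) (r ℕ.* j)) ⟩
          -- The exponent is commuted so that it reads as the k-th power of q^j.
          b * (q ^ (k ℕ.* j) * q ^ (r ℕ.* j))        ≈⟨ *-congˡ (*-cong (^-congʳ q (ℕ.*-comm k j)) (sym (q^fromℕ (r ℕ.* j)))) ⟩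
          b * (q ^ (j ℕ.* k) * Q)                    ≈⟨ *-congˡ (*-congʳ (^-assocʳ q j k)) ⟨
          b * ((q ^ j) ^ k * Q)                      ≈⟨ *-congˡ (*-congʳ (^-congˡ k (q^fromℕ j))) ⟨
          b * (x ^ k * Q)                            ≈⟨ solve 3 (λ b y Q → b :* (y :* Q) := Q :* (b :* y)) refl b (x ^ k) Q ⟩
          Q * (b * x ^ k)                            ∎
          where
          k = toℕ l
          b = signedBinomial k

      -- Raising j by one multiplies the k-th term by q^(k + r). By the hypothesis on `a` this
      -- replaces a_k by a_k + 1: the a_k rebuild the old value and the ones form the increment.
      q^[rj]*carlitz-suc : ∀ a → (∀ k → a k * q ^ (k ℕ.+ r) ≈ a k + 1#) → ∀ j →
        q^ fromℕ (r ℕ.* suc j) * carlitz a n (fromℕ (suc j))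
          ≈ q^ fromℕ (r ℕ.* j) * carlitz a n (fromℕ j) + q^ fromℕ (r ℕ.* j) * [ fromℕ j ] ^ n
      q^[rj]*carlitz-suc a a*q^≈a+1 j = begin
        q^ fromℕ (r ℕ.* suc j) * carlitz a n (fromℕ (suc j))     ≈⟨ q^[rj]*carlitz a (suc j) ⟩
        i ^ n * sum {suc n} (λ l → b l * a (toℕ l) * q ^ ((toℕ l ℕ.+ r) ℕ.* suc j))
                                                                 ≈⟨ *-congˡ (sum-cong-≋ {suc n} term) ⟩
        i ^ n * sum {suc n} (λ l → T l + D l)                    ≈⟨ *-congˡ (∑-distrib-+ {suc n} T D) ⟩
        i ^ n * (sum {suc n} T + sum {suc n} D)                  ≈⟨ distribˡ (i ^ n) (sum {suc n} T) (sum {suc n} D) ⟩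
        i ^ n * sum {suc n} T + i ^ n * sum {suc n} D            ≈⟨ +-cong (sym (q^[rj]*carlitz a j)) (q^[rj]*[j]^n j) ⟩
        q^ fromℕ (r ℕ.* j) * carlitz a n (fromℕ j) + q^ fromℕ (r ℕ.* j) * [ fromℕ j ] ^ n ∎
        where
        b T D : Fin (suc n) → Carrier
        b l = signedBinomial (toℕ l)
        T l = b l * a (toℕ l) * q ^ ((toℕ l ℕ.+ r) ℕ.* j)
        D l = b l * q ^ ((toℕ l ℕ.+ r) ℕ.* j)

        term : ∀ l → b l * a (toℕ l) * q ^ ((toℕ l ℕ.+ r) ℕ.* suc j) ≈ T l + D l
        term l = begin
          b l * a k * q ^ (m ℕ.* suc j)                    ≈⟨ *-congˡ (^-congʳ q (ℕ.*-suc m j)) ⟩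
          b l * a k * q ^ (m ℕ.+ m ℕ.* j)                  ≈⟨ *-congˡ (^-homo-* q m (m ℕ.* j)) ⟩
          b l * a k * (q ^ m * y)                          ≈⟨ solve 4 (λ b a e y → b :* a :* (e :* y) := b :* (a :* e) :* y) refl (b l) (a k) (q ^ m) y ⟩
          b l * (a k * q ^ m) * y                          ≈⟨ *-congʳ (*-congˡ (a*q^≈a+1 k)) ⟩
          b l * (a k + 1#) * y                             ≈⟨ solve 3 (λ b a y → b :* (a :+ con 1) :* y := b :* a :* y :+ b :* y) refl (b l) (a k) y ⟩
          b l * a k * y + b l * y                          ∎
          where
          k = toℕ l
          m = k ℕ.+ r
          y = q ^ (m ℕ.* j)

      sum-q^[rk]*[k]^n : ∀ a → (∀ k → a k * q ^ (k ℕ.+ r) ≈ a k + 1#) → ∀ N →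
        sum {N} (λ l → q^ fromℕ (r ℕ.* toℕ l) * [ fromℕ (toℕ l) ] ^ n)
          ≈ q^ fromℕ (r ℕ.* N) * carlitz a n (fromℕ N) - carlitz a n 0#
      sum-q^[rk]*[k]^n a a*q^≈a+1 N = begin
        Σf                         ≈⟨ xyx⁻¹≈y (F 0) Σf ⟨
        -- The telescoped identity is additive; subtracting `F 0` isolates the sum.
        F 0 + Σf - F 0             ≈⟨ +-cong (sym (telescope F f (q^[rj]*carlitz-suc a a*q^≈a+1) N)) (-‿cong F0≈) ⟩
        F N - carlitz a n 0#       ∎
        where
        F f : ℕ → Carrier
        F j = q^ fromℕ (r ℕ.* j) * carlitz a n (fromℕ j)
        f j = q^ fromℕ (r ℕ.* j) * [ fromℕ j ] ^ n

        Σf : Carrier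
        Σf = sum {N} (λ l → f (toℕ l))

        F0≈ : F 0 ≈ carlitz a n 0#
        F0≈ = begin
          -- `fromℕ 0` computes to `0#`, but `r ℕ.* 0` is stuck on the variable `r` and has to be
          -- rewritten.
          q^ fromℕ (r ℕ.* 0) * carlitz a n 0#     ≡⟨ ≡.cong (λ m → q^ fromℕ m * carlitz a n 0#) (ℕ.*-zeroʳ r) ⟩
          q^ 0# * carlitz a n 0#                  ≈⟨ *-congʳ q^0≈1 ⟩
          1# * carlitz a n 0#                     ≈⟨ *-identityˡ _ ⟩
          carlitz a n 0#                          ∎

theorem2p6 :
    ∀ {c ℓ₁ ℓ₂} (ℝ : RealNumbers c ℓ₁ ℓ₂) →
    let open RealNumbers ℝ in
    (q : Carrier) (0<q : 0# < q) (q#1 : q # 1#) (power : PowerFunction ℝ q) →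
    let open Carlitz ℝ 0<q q#1 power in
    (r : ℕ) .{{_ : NonZero r}} →
    let S : ℕ → Carrier → Carrier
        S = carlitz (λ k → (q - 1#) ⁻¹⟨ q-1#0 ⟩ * [ fromℕ (k ℕ.+ r) ] ⁻¹⟨ [k+r]#0 k r ⟩) in
    (n N : ℕ) .{{_ : NonZero N}} →
    sum {N} (λ i → let k = toℕ i in q^ fromℕ (r ℕ.* k) * [ fromℕ k ] ^ n)
      ≈ q^ fromℕ (r ℕ.* N) * S n (fromℕ N) - S n 0#
theorem2p6 ℝ q 0<q q#1 power r n N =
  sum-q^[rk]*[k]^n ℝ 0<q q#1 power r n _
    -- Here m = k + r, whose bracket is apart from zero because `r` is positive.
    (λ k → a*q^m≈a+1 ℝ 0<q q#1 power (k ℕ.+ r) (Carlitz.[k+r]#0 ℝ 0<q q#1 power k r)) N
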